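{- Let $\mathbf{L}\in\mathbf{DQD}$ with $|L|>2$. Then the following are equivalent: (1) $\mathbf{L}$ is a subdirectly irreducible algebra in $\mathbf{JIDL_1}$; (2) $\mathbf{L}$ is a simple algebra in $\mathbf{JIDL_1}$; (3) $\mathbf{L}\in\mathbf{JIDL_1}$ and, for every $x\in L$, if $x\neq 1$ then $x\wedge (x')^*=0$; (4) $\mathbf{L}\cong\mathbf{D_2}$, or $\mathbf{L}$ is a $\mathbf{DStH}$-chain.
   Context: A semi-Heyting algebra is an algebra $\langle L,\vee,\wedge,\to,0,1\rangle$ such that $\langle L,\vee,\wedge,0,1\rangle$ is a bounded lattice and the identities $x\wedge(x\to y)\approx x\wedge y$, $x\wedge(y\to z)\approx x\wedge[(x\wedge y)\to(x\wedge z)]$, $x\to x\approx 1$ hold; it is a Heyting algebra if moreover $(x\wedge y)\to y\approx 1$. Write $x^*:=x\to 0$. A $\mathbf{DQD}$-algebra (dually quasi-De Morgan semi-Heyting algebra) is an algebra $\langle L,\vee,\wedge,\to,{}',0,1\rangle$ whose reduct $\langle L,\vee,\wedge,\to,0,1\rangle$ is a semi-Heyting algebra and which satisfies: $0'\approx 1$ and $1'\approx 0$; $(x\wedge y)'\approx x'\vee y'$; $(x\vee y)''\approx x''\vee y''$; $x''\le x$. $\mathbf{DQD}$ denotes the variety of all $\mathbf{DQD}$-algebras. $\mathbf{JIDL_1}$ is the subvariety of $\mathbf{DQD}$ defined by the identities $x'\vee(y\to z)\approx(x'\vee y)\to(x'\vee z)$, $(x\to y)\vee(y\to x)\approx 1$,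 and $x\wedge x'^{*}\approx (x\wedge x'^{*})'^{*}$ (where $z'^*$ means $(z')^*$); in the presence of the first identity, the last is equivalent to the level-1 identity $x\wedge x'^*\approx x\wedge x'^*\wedge x'^*{}'^*$. A $\mathbf{DStH}$-chain is a $\mathbf{DQD}$-algebra satisfying $x'\wedge x''\approx 0$ whose semi-Heyting reduct is a Heyting algebra and whose lattice reduct is a chain. $\mathbf{D_2}$ is the $\mathbf{DQD}$-algebra whose reduct without $'$ is the four-element Boolean algebra $\{0,a,b,1\}$ with its Heyting implication ($x\to y$ is the join of the complement of $x$ with $y$), and with $0'=1$, $1'=0$, $a'=a$, $b'=b$. -}

module Defs where

open import Level using (Level; _⊔_; suc; 0ℓ)
open import Algebra.Core using (Op₁; Op₂)
import Algebra.Definitions as Def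
open import Algebra.Lattice.Structures using (IsLattice)
open import Algebra.Morphism.Definitions
  using (Homomorphic₀; Homomorphic₁; Homomorphic₂)
open import Data.Bool.Base as Bool using (Bool; true; false)
open import Data.Fin.Base using (Fin)
open import Data.Product.Base using (_×_; _,_; Σ-syntax; ∃-syntax)
open import Data.Sum.Base using (_⊎_)
open import Function.Definitions
  using (Congruent; Injective; StrictlySurjective; Bijective)
open import Relation.Binary.Core using (Rel)
open import Relation.Binary.Definitions using (Total)
open import Relation.Binary.Structures using (IsEquivalence)
open import Relation.Binary.PropositionalEquality
  using (_≡_; cong; cong₂)
  renaming (isEquivalence to ≡-isEquivalence)

-- Arbitrary algebras of type ⟨∨, ∧, →, ′, 0, 1⟩; no identities are assumed.
-- The equality of elements is the setoid equality _≈_.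
record Algebra (c ℓ : Level) : Set (suc (c ⊔ ℓ)) where
  infix  9 _′
  infixr 7 _∧_
  infixr 6 _∨_
  infixr 5 _⇒_
  infix  4 _≈_ _≤_
  field
    Carrier         : Set c
    _≈_             : Rel Carrier ℓ
    _∨_ _∧_ _⇒_     : Op₂ Carrier
    _′              : Op₁ Carrier
    0# 1#           : Carrier
    ≈-isEquivalence : IsEquivalence _≈_
    ∨-congruent     : Def.Congruent₂ _≈_ _∨_
    ∧-congruent     : Def.Congruent₂ _≈_ _∧_
    ⇒-congruent     : Def.Congruent₂ _≈_ _⇒_
    ′-congruent     : Def.Congruent₁ _≈_ _′

  infix 9 _*
  _* : Op₁ Carrier
  x * = x ⇒ 0#

  _≤_ : Rel Carrier ℓ
  x ≤ y = x ∧ y ≈ x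

module _ {c ℓ} (L : Algebra c ℓ) where
  open Algebra L

  record IsSemiHeyting : Set (c ⊔ ℓ) where
    field
      isLattice : IsLattice _≈_ _∨_ _∧_
      ∧-zeroʳ   : Def.RightZero _≈_ 0# _∧_
      ∨-zeroʳ   : Def.RightZero _≈_ 1# _∨_
      ∧-⇒       : ∀ x y → x ∧ (x ⇒ y) ≈ x ∧ y
      ∧-⇒-rel   : ∀ x y z → x ∧ (y ⇒ z) ≈ x ∧ ((x ∧ y) ⇒ (x ∧ z))
      ⇒-refl    : ∀ x → x ⇒ x ≈ 1#

  record IsHeyting : Set (c ⊔ ℓ) where
    field
      isSemiHeyting : IsSemiHeyting
      ∧-⇒-≈1        : ∀ x y → (x ∧ y) ⇒ y ≈ 1#

  record IsDQD : Set (c ⊔ ℓ) where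
    field
      isSemiHeyting : IsSemiHeyting
      0′            : 0# ′ ≈ 1#
      1′            : 1# ′ ≈ 0#
      ∧-′           : ∀ x y → (x ∧ y) ′ ≈ x ′ ∨ y ′
      ∨-′′          : ∀ x y → ((x ∨ y) ′) ′ ≈ (x ′) ′ ∨ (y ′) ′
      ′′-≤          : ∀ x → (x ′) ′ ≤ x

  record IsJIDL₁ : Set (c ⊔ ℓ) where
    field
      isDQD : IsDQD
      jid   : ∀ x y z → x ′ ∨ (y ⇒ z) ≈ (x ′ ∨ y) ⇒ (x ′ ∨ z)
      lin   : ∀ x y → (x ⇒ y) ∨ (y ⇒ x) ≈ 1#
      lev₁  : ∀ x → x ∧ (x ′) * ≈ ((x ∧ (x ′) *) ′) *

  record IsDStHChain : Set (c ⊔ ℓ) where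
    field
      isDQD     : IsDQD
      dualStone : ∀ x → x ′ ∧ (x ′) ′ ≈ 0#
      isHeyting : IsHeyting
      isChain   : Total _≤_

  HasMoreThanTwoElements : Set (c ⊔ ℓ)
  HasMoreThanTwoElements = Σ[ f ∈ (Fin 3 → Carrier) ] Injective _≡_ _≈_ f

  record IsCongruence {r} (θ : Rel Carrier r) : Set (c ⊔ ℓ ⊔ r) where
    field
      isEquivalence : IsEquivalence θ
      ≈⇒θ           : ∀ {x y} → x ≈ y → θ x y
      ∨-compatible  : Def.Congruent₂ θ _∨_
      ∧-compatible  : Def.Congruent₂ θ _∧_
      ⇒-compatible  : Def.Congruent₂ θ _⇒_
      ′-compatible  : Def.Congruent₁ θ _′

  -- Every congruence is the diagonal or the full relation.  The level c ⊔ ℓ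
  -- is the one at which generated congruences and kernels live.
  IsSimple : Set (suc (c ⊔ ℓ))
  IsSimple = (θ : Rel Carrier (c ⊔ ℓ)) → IsCongruence θ →
             (∀ x y → θ x y → x ≈ y) ⊎ (∀ x y → θ x y)

module _ {c₁ ℓ₁ c₂ ℓ₂} (A : Algebra c₁ ℓ₁) (B : Algebra c₂ ℓ₂) where
  private
    module A = Algebra A
    module B = Algebra B

  record IsHomomorphism (h : A.Carrier → B.Carrier) :
                        Set (c₁ ⊔ ℓ₁ ⊔ c₂ ⊔ ℓ₂) where
    field
      h-cong : Congruent A._≈_ B._≈_ h
      ∨-homo : Homomorphic₂ A.Carrier B.Carrier B._≈_ h A._∨_ B._∨_
      ∧-homo : Homomorphic₂ A.Carrier B.Carrier B._≈_ h A._∧_ B._∧_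
      ⇒-homo : Homomorphic₂ A.Carrier B.Carrier B._≈_ h A._⇒_ B._⇒_
      ′-homo : Homomorphic₁ A.Carrier B.Carrier B._≈_ h A._′ B._′
      0-homo : Homomorphic₀ A.Carrier B.Carrier B._≈_ h A.0# B.0#
      1-homo : Homomorphic₀ A.Carrier B.Carrier B._≈_ h A.1# B.1#

  record IsIsomorphism (h : A.Carrier → B.Carrier) :
                       Set (c₁ ⊔ ℓ₁ ⊔ c₂ ⊔ ℓ₂) where
    field
      isHomomorphism : IsHomomorphism h
      bijective      : Bijective A._≈_ B._≈_ h

  infix 4 _≅_
  _≅_ : Set (c₁ ⊔ ℓ₁ ⊔ c₂ ⊔ ℓ₂)
  _≅_ = ∃[ h ] IsIsomorphism h

Π : ∀ {i c ℓ} {I : Set i} → (I → Algebra c ℓ) → Algebra (i ⊔ c) (i ⊔ ℓ)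
Π {I = I} B = record
  { Carrier         = ∀ i → B.Carrier i
  ; _≈_             = λ f g → ∀ i → B._≈_ i (f i) (g i)
  ; _∨_             = λ f g i → B._∨_ i (f i) (g i)
  ; _∧_             = λ f g i → B._∧_ i (f i) (g i)
  ; _⇒_             = λ f g i → B._⇒_ i (f i) (g i)
  ; _′              = λ f i → B._′ i (f i)
  ; 0#              = λ i → B.0# i
  ; 1#              = λ i → B.1# i
  ; ≈-isEquivalence = record
    { refl  = λ i → IsEquivalence.refl (B.≈-isEquivalence i)
    ; sym   = λ p i → IsEquivalence.sym (B.≈-isEquivalence i) (p i)
    ; trans = λ p q i → IsEquivalence.trans (B.≈-isEquivalence i) (p i) (q i)
    }
  ; ∨-congruent     = λ p q i → B.∨-congruent i (p i) (q i)
  ; ∧-congruent     = λ p q i → B.∧-congruent i (p i) (q i)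
  ; ⇒-congruent     = λ p q i → B.⇒-congruent i (p i) (q i)
  ; ′-congruent     = λ p i → B.′-congruent i (p i)
  }
  where module B (i : I) = Algebra (B i)

record IsSubdirectEmbedding
  {c ℓ i c′ ℓ′} (L : Algebra c ℓ) {I : Set i} (B : I → Algebra c′ ℓ′)
  (α : Algebra.Carrier L → Algebra.Carrier (Π B)) :
  Set (c ⊔ ℓ ⊔ i ⊔ c′ ⊔ ℓ′) where
  field
    isHomomorphism : IsHomomorphism L (Π B) α
    injective      : Injective (Algebra._≈_ L) (Algebra._≈_ (Π B)) α
    projections    : ∀ i → StrictlySurjective (Algebra._≈_ (B i)) (λ x → α x i)

-- Every subdirect embedding is an isomorphism onto one of its factors.  The
-- factors are surjective images of L, so up to isomorphism they are quotients
-- of L by congruences of level c ⊔ ℓ; hence the levels of the family.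
IsSubdirectlyIrreducible : ∀ {c ℓ} → Algebra c ℓ → Set (suc (c ⊔ ℓ))
IsSubdirectlyIrreducible {c} {ℓ} L =
  (I : Set (c ⊔ ℓ)) (B : I → Algebra c (c ⊔ ℓ))
  (α : Algebra.Carrier L → Algebra.Carrier (Π B)) →
  IsSubdirectEmbedding L B α →
  ∃[ i ] IsIsomorphism L (B i) (λ x → α x i)

-- The four-element Boolean algebra as Bool × Bool, with a = (true , false) and
-- b = (false , true).
D₂ : Algebra 0ℓ 0ℓ
D₂ = record
  { Carrier         = Bool × Bool
  ; _≈_             = _≡_
  ; _∨_             = join
  ; _∧_             = meet
  ; _⇒_             = λ x y → join (complement x) y
  ; _′              = prime
  ; 0#              = false , false
  ; 1#              = true , true
  ; ≈-isEquivalence = ≡-isEquivalence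
  ; ∨-congruent     = cong₂ join
  ; ∧-congruent     = cong₂ meet
  ; ⇒-congruent     = cong₂ (λ x y → join (complement x) y)
  ; ′-congruent     = cong prime
  }
  where
  join meet : Op₂ (Bool × Bool)
  join (p , q) (r , s) = p Bool.∨ r , q Bool.∨ s
  meet (p , q) (r , s) = p Bool.∧ r , q Bool.∧ s

  complement prime : Op₁ (Bool × Bool)
  complement (p , q) = Bool.not p , Bool.not q
  prime (false , false) = true  , true
  prime (true  , false) = true  , false
  prime (false , true)  = false , true
  prime (true  , true)  = false , false

{-# OPTIONS --safe #-}
module Submission where

-- Let L be a DQD-algebra in which 0 and 1 differ.
--
-- (1) ⇒ (3).  The identity x′ ∨ (y → z) ≈ (x′ ∨ y) → (x′ ∨ z), taken at y = x′
-- and z = 0, says that x′ ∨ x′* = 1, so every x′ is complemented by x′*.  For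
-- a = x ∧ x′* the last defining identity of JIDL₁ reads a = a′*, so a and a′ are
-- complements.  Whenever c ∧ c′ = 0, equality below c (that is, c ∧ x = c ∧ y) is
-- a congruence; the congruences for a and for a′ meet in the diagonal.  In a
-- subdirectly irreducible algebra one of them is therefore the diagonal, which
-- forces a = 1 (and then x = 1) or a = 0: see complemented⇒trivial.
--
-- (3) ⇒ (2).  Since x → y = 1 = y → x forces x = y, a congruence other than the
-- diagonal relates 1 to some u of the form x → y with u ≠ 1, and hence relates
-- 1 = 1 ∧ 1′* to u ∧ u′* = 0.
--
-- (2) ⇒ (1).  The kernels of the projections of a subdirect embedding are trivial
-- or full, and not all of them are full.
--
-- (3) ⇒ (4).  As x′ and x′* are complements, x ∧ x′* = 0 means x ≤ x′.  Applied to
-- x and to x′, and together with x′′ ≤ x, condition (3) gives a trichotomy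
-- (classify): x = 1, or x′ = 1, or x′ = x.
--   * If ′ has no fixed point, then x ≠ 1 implies x′ = 1 and x′′ = 0.  As
--     double ′ preserves joins, 1 is join-irreducible; linearity,
--     (x → y) ∨ (y → x) = 1, then makes L a chain and → a Heyting implication.
--   * If a is a fixed point, so is its complement b = a*.  Every x with x′ = 1
--     lies below both and is 0.  A fixed point other than a and b would join to 1
--     with both, hence be 1.  So the lattice reduct of L is that of D₂.  The
--     implication is determined below a and below b by its values on 0 and 1,
--     which are those of a Boolean algebra since linearity yields 0 → 1 = 1.
--
-- (4) ⇒ (3).  D₂ is checked by cases, and identities are reflected along the
-- isomorphism.  In a DStH-chain x′ is 0 for x = 1 and 1 otherwise, which makes
-- every identity of JIDL₁ immediate.

open import Defs
open import Level using (Level; _⊔_; Lift; lift; lower)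
open import Axiom.ExcludedMiddle using (ExcludedMiddle)
open import Algebra.Lattice.Structures using (IsLattice)
import Algebra.Lattice.Bundles as AlgLattice
import Algebra.Lattice.Properties.Lattice as AlgLatticeProperties
open import Data.Bool.Base as Bool using (Bool; true; false; if_then_else_)
open import Data.Fin.Base using (zero; suc)
open import Data.Product.Base using (Σ-syntax; ∃-syntax; _×_; _,_; proj₁; proj₂)
open import Data.Sum.Base using (_⊎_; inj₁; inj₂)
open import Function.Base using (id; _∘_)
open import Function.Bundles using (_⇔_; mk⇔)
open import Function.Consequences using (strictlySurjective⇒surjective)
open import Function.Definitions using (Injective; StrictlySurjective)
open import Relation.Binary.Bundles using (Setoid)
open import Relation.Binary.Core using (Rel)
open import Relation.Binary.Definitions using (Total)
open import Relation.Binary.Lattice using (HeytingAlgebra) renaming (Lattice to OrderLattice)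
import Relation.Binary.Lattice.Properties.MeetSemilattice as MeetProperties
import Relation.Binary.Lattice.Properties.BoundedJoinSemilattice as BoundedJoinProperties
import Relation.Binary.Lattice.Properties.BoundedLattice as BoundedLatticeProperties
import Relation.Binary.Lattice.Properties.BoundedMeetSemilattice as BoundedMeetProperties
import Relation.Binary.Lattice.Properties.HeytingAlgebra as HeytingProperties
open import Relation.Binary.PropositionalEquality as ≡ using (_≡_)
import Relation.Binary.Reasoning.PartialOrder as ≤-Reasoning
import Relation.Binary.Reasoning.Setoid as ≈-Reasoning
open import Relation.Binary.Structures using (IsEquivalence)
open import Relation.Nullary.Decidable.Core using (Dec; yes; no; map′; decidable-stable)
open import Relation.Nullary.Negation using (¬_; contradiction)

-- Semi-Heyting algebras

module SemiHeyting {c ℓ : Level} (L : Algebra c ℓ) (isSemiHeyting : IsSemiHeyting L) where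
  open Algebra L public hiding (_≤_)
  open IsSemiHeyting isSemiHeyting public
  open IsLattice isLattice public
    using (refl; sym; trans; ∨-comm; ∧-comm; ∧-assoc; ∨-cong; ∨-congˡ; ∨-congʳ;
           ∧-cong; ∧-congˡ; ∧-congʳ; ∧-absorbs-∨)

  setoid : Setoid c ℓ
  setoid = record { isEquivalence = ≈-isEquivalence }

  private
    latticeBundle : AlgLattice.Lattice c ℓ
    latticeBundle = record { isLattice = isLattice }

  open AlgLatticeProperties latticeBundle public
    using (∧-idem; ∨-idem; ∨-∧-isOrderTheoreticLattice)

  orderLattice : OrderLattice c ℓ ℓ
  orderLattice = record { isLattice = ∨-∧-isOrderTheoreticLattice }

  -- The lattice order in the orientation of the order-theoretic lattice above:
  -- x ⊑ y unfolds to x ≈ x ∧ y, whereas x ≤ y is the equation x ∧ y ≈ x.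
  open OrderLattice orderLattice public
    using (poset; antisym; x≤x∨y; y≤x∨y; ∨-least; x∧y≤x; x∧y≤y; ∧-greatest)
    renaming (_≤_ to infix 4 _⊑_; trans to ⊑-trans; refl to ⊑-refl; reflexive to ⊑-reflexive)
  open MeetProperties (OrderLattice.meetSemilattice orderLattice) public using (∧-monotonic)

  ∧-identityʳ : ∀ x → x ∧ 1# ≈ x
  ∧-identityʳ x = trans (∧-congˡ (sym (∨-zeroʳ x))) (∧-absorbs-∨ x 1#)

  ∧-∧-absorb : ∀ x y → x ∧ (x ∧ y) ≈ x ∧ y
  ∧-∧-absorb x y = trans (sym (∧-assoc x x y)) (∧-congʳ (∧-idem x))

  -- The operation y ⇒ (y ∧ z) is the relative pseudocomplement of the lattice
  -- reduct, even where ⇒ itself is not.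
  heytingAlgebra : HeytingAlgebra c ℓ ℓ
  heytingAlgebra = record
    { isHeytingAlgebra = record
      { isBoundedLattice = record
        { isLattice = ∨-∧-isOrderTheoreticLattice
        ; maximum   = λ x → sym (∧-identityʳ x)
        ; minimum   = λ x → sym (trans (∧-comm 0# x) (∧-zeroʳ x))
        }
      ; exponential = λ w x y → curry w x y , uncurry w x y
      }
    }
    where
    curry : ∀ w x y → w ∧ x ⊑ y → w ⊑ x ⇒ (x ∧ y)
    curry w x y w∧x⊑y = sym (begin
      w ∧ (x ⇒ (x ∧ y))              ≈⟨ ∧-⇒-rel w x (x ∧ y) ⟩
      w ∧ ((w ∧ x) ⇒ (w ∧ (x ∧ y)))  ≈⟨ ∧-congˡ (⇒-congruent refl
                                          (trans (sym (∧-assoc w x y)) (sym w∧x⊑y))) ⟩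
      w ∧ ((w ∧ x) ⇒ (w ∧ x))        ≈⟨ ∧-congˡ (⇒-refl (w ∧ x)) ⟩
      w ∧ 1#                         ≈⟨ ∧-identityʳ w ⟩
      w                              ∎)
      where open ≈-Reasoning setoid

    uncurry : ∀ w x y → w ⊑ x ⇒ (x ∧ y) → w ∧ x ⊑ y
    uncurry w x y w⊑ = begin
      w ∧ x              ≤⟨ ∧-monotonic w⊑ ⊑-refl ⟩
      (x ⇒ (x ∧ y)) ∧ x  ≈⟨ ∧-comm _ _ ⟩
      x ∧ (x ⇒ (x ∧ y))  ≈⟨ ∧-⇒ x (x ∧ y) ⟩
      x ∧ (x ∧ y)        ≤⟨ ⊑-trans (x∧y≤y x _) (x∧y≤y x y) ⟩
      y                  ∎
      where open ≤-Reasoning poset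

  open HeytingAlgebra heytingAlgebra public using (maximum; minimum)
  open HeytingProperties heytingAlgebra public using (∧-distribˡ-∨)
  open BoundedLatticeProperties (HeytingAlgebra.boundedLattice heytingAlgebra) public
    using (∧-zeroˡ; ∨-zeroˡ)
  open BoundedMeetProperties (HeytingAlgebra.boundedMeetSemilattice heytingAlgebra) public
    using () renaming (identityˡ to ∧-identityˡ)
  open BoundedJoinProperties (HeytingAlgebra.boundedJoinSemilattice heytingAlgebra) public
    using () renaming (identityˡ to ∨-identityˡ; identityʳ to ∨-identityʳ)

  ⊑0⇒≈0 : ∀ {x} → x ⊑ 0# → x ≈ 0#
  ⊑0⇒≈0 {x} x⊑0 = antisym x⊑0 (minimum x)

  1⊑⇒≈1 : ∀ {x} → 1# ⊑ x → x ≈ 1#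
  1⊑⇒≈1 {x} 1⊑x = antisym (maximum x) 1⊑x

  1⇒-identity : ∀ x → 1# ⇒ x ≈ x
  1⇒-identity x = trans (sym (∧-identityˡ _)) (trans (∧-⇒ 1# x) (∧-identityˡ x))

  1*≈0 : 1# * ≈ 0#
  1*≈0 = 1⇒-identity 0#

  ∧-*≈0 : ∀ x → x ∧ x * ≈ 0#
  ∧-*≈0 x = trans (∧-⇒ x 0#) (∧-zeroʳ x)

  ⇒≈1⇒⊑ : ∀ {x y} → x ⇒ y ≈ 1# → x ⊑ y
  ⇒≈1⇒⊑ {x} {y} x⇒y≈1 =
    trans (sym (∧-identityʳ x)) (trans (∧-congˡ (sym x⇒y≈1)) (∧-⇒ x y))

  ∨≈1∧≈0⇒⊑ : ∀ {a x y} → a ∨ y ≈ 1# → x ∧ a ≈ 0# → x ⊑ y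
  ∨≈1∧≈0⇒⊑ {a} {x} {y} a∨y≈1 x∧a≈0 = begin
    x                    ≈⟨ ∧-identityʳ x ⟨
    x ∧ 1#               ≈⟨ ∧-congˡ a∨y≈1 ⟨
    x ∧ (a ∨ y)          ≈⟨ ∧-distribˡ-∨ x a y ⟩
    (x ∧ a) ∨ (x ∧ y)    ≈⟨ ∨-congʳ x∧a≈0 ⟩
    0# ∨ (x ∧ y)         ≈⟨ ∨-identityˡ _ ⟩
    x ∧ y                ∎
    where open ≈-Reasoning setoid

  -- Equality below a: the congruence of the semi-Heyting reduct generated by
  -- identifying a with 1.
  infix 4 _≈[_]_
  _≈[_]_ : Carrier → Carrier → Carrier → Set ℓ
  x ≈[ a ] y = a ∧ x ≈ a ∧ y

  ≈[]-∨ : ∀ {a x y u v} → x ≈[ a ] y → u ≈[ a ] v → x ∨ u ≈[ a ] y ∨ v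
  ≈[]-∨ {a} {x} {y} {u} {v} x≈y u≈v = begin
    a ∧ (x ∨ u)          ≈⟨ ∧-distribˡ-∨ a x u ⟩
    (a ∧ x) ∨ (a ∧ u)    ≈⟨ ∨-cong x≈y u≈v ⟩
    (a ∧ y) ∨ (a ∧ v)    ≈⟨ ∧-distribˡ-∨ a y v ⟨
    a ∧ (y ∨ v)          ∎
    where open ≈-Reasoning setoid

  ≈[]-∧ : ∀ {a x y u v} → x ≈[ a ] y → u ≈[ a ] v → x ∧ u ≈[ a ] y ∧ v
  ≈[]-∧ {a} {x} {y} {u} {v} x≈y u≈v = begin
    a ∧ (x ∧ u)    ≈⟨ ∧-assoc a x u ⟨
    (a ∧ x) ∧ u    ≈⟨ ∧-congʳ (trans x≈y (∧-comm a y)) ⟩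
    (y ∧ a) ∧ u    ≈⟨ ∧-assoc y a u ⟩
    y ∧ (a ∧ u)    ≈⟨ ∧-congˡ u≈v ⟩
    y ∧ (a ∧ v)    ≈⟨ ∧-assoc y a v ⟨
    (y ∧ a) ∧ v    ≈⟨ ∧-congʳ (∧-comm y a) ⟩
    (a ∧ y) ∧ v    ≈⟨ ∧-assoc a y v ⟩
    a ∧ (y ∧ v)    ∎
    where open ≈-Reasoning setoid

  ≈[]-⇒ : ∀ {a x y u v} → x ≈[ a ] y → u ≈[ a ] v → x ⇒ u ≈[ a ] y ⇒ v
  ≈[]-⇒ {a} {x} {y} {u} {v} x≈y u≈v =
    trans (∧-⇒-rel a x u)
      (trans (∧-congˡ (⇒-congruent x≈y u≈v)) (sym (∧-⇒-rel a y v)))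

  ≈[]-separates : ∀ {a b x y} → a ∨ b ≈ 1# → x ≈[ a ] y → x ≈[ b ] y → x ≈ y
  ≈[]-separates {a} {b} {x} {y} a∨b≈1 x≈y x≈y′ = begin
    x                    ≈⟨ split x ⟩
    (a ∧ x) ∨ (b ∧ x)    ≈⟨ ∨-cong x≈y x≈y′ ⟩
    (a ∧ y) ∨ (b ∧ y)    ≈⟨ split y ⟨
    y                    ∎
    where
    open ≈-Reasoning setoid
    split : ∀ z → z ≈ (a ∧ z) ∨ (b ∧ z)
    split z = begin
      z                    ≈⟨ ∧-identityʳ z ⟨
      z ∧ 1#               ≈⟨ ∧-congˡ a∨b≈1 ⟨
      z ∧ (a ∨ b)          ≈⟨ ∧-distribˡ-∨ z a b ⟩
      (z ∧ a) ∨ (z ∧ b)    ≈⟨ ∨-cong (∧-comm z a) (∧-comm z b) ⟩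
      (a ∧ z) ∨ (b ∧ z)    ∎

-- Dually quasi-De Morgan algebras

module DQD {c ℓ : Level} (L : Algebra c ℓ) (isDQD : IsDQD L) where
  open IsDQD isDQD public using (0′; 1′; ∧-′; ∨-′′; ′′-≤)
  open SemiHeyting L (IsDQD.isSemiHeyting isDQD) public

  ′′-⊑ : ∀ x → (x ′) ′ ⊑ x
  ′′-⊑ x = sym (′′-≤ x)

  ′-antitone : ∀ {x y} → x ⊑ y → y ′ ⊑ x ′
  ′-antitone {x} {y} x⊑y = begin
    y ′          ≤⟨ y≤x∨y (x ′) (y ′) ⟩
    x ′ ∨ y ′    ≈⟨ ∧-′ x y ⟨
    (x ∧ y) ′    ≈⟨ ′-congruent x⊑y ⟨
    x ′          ∎
    where open ≤-Reasoning poset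

  ′′′≈′ : ∀ x → ((x ′) ′) ′ ≈ x ′
  ′′′≈′ x = antisym (′′-⊑ (x ′)) (′-antitone (′′-⊑ x))

  ′≈1⇒′′≈0 : ∀ {x} → x ′ ≈ 1# → (x ′) ′ ≈ 0#
  ′≈1⇒′′≈0 x′≈1 = trans (′-congruent x′≈1) 1′

  ′≈0⇒≈1 : ∀ {x} → x ′ ≈ 0# → x ≈ 1#
  ′≈0⇒≈1 {x} x′≈0 = 1⊑⇒≈1 (⊑-trans (⊑-reflexive (sym (trans (′-congruent x′≈0) 0′))) (′′-⊑ x))

  ≈1⇒∧′*≈1 : ∀ {x} → x ≈ 1# → x ∧ (x ′) * ≈ 1#
  ≈1⇒∧′*≈1 {x} x≈1 = begin
    x ∧ (x ′) *    ≈⟨ ∧-cong x≈1 (⇒-congruent (trans (′-congruent x≈1) 1′) refl) ⟩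
    1# ∧ 0# *      ≈⟨ ∧-identityˡ _ ⟩
    0# *           ≈⟨ ⇒-refl 0# ⟩
    1#             ∎
    where open ≈-Reasoning setoid

  ≈[]-′ : ∀ {a x y} → a ∧ a ′ ≈ 0# → x ≈[ a ] y → x ′ ≈[ a ] y ′
  ≈[]-′ {a} {x} {y} a∧a′≈0 x≈y = begin
    a ∧ x ′        ≈⟨ below x ⟨
    a ∧ (a ∧ x) ′  ≈⟨ ∧-congˡ (′-congruent x≈y) ⟩
    a ∧ (a ∧ y) ′  ≈⟨ below y ⟩
    a ∧ y ′        ∎
    where
    open ≈-Reasoning setoid
    below : ∀ z → a ∧ (a ∧ z) ′ ≈ a ∧ z ′
    below z = begin
      a ∧ (a ∧ z) ′            ≈⟨ ∧-congˡ (∧-′ a z) ⟩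
      a ∧ (a ′ ∨ z ′)          ≈⟨ ∧-distribˡ-∨ a (a ′) (z ′) ⟩
      (a ∧ a ′) ∨ (a ∧ z ′)    ≈⟨ ∨-congʳ a∧a′≈0 ⟩
      0# ∨ (a ∧ z ′)           ≈⟨ ∨-identityˡ _ ⟩
      a ∧ z ′                  ∎

  -- The quotient of L by equality below a, which is a congruence of L as soon
  -- as a ∧ a ′ ≈ 0#.
  quotient : Σ[ a ∈ Carrier ] a ∧ a ′ ≈ 0# → Algebra c (c ⊔ ℓ)
  quotient (a , a∧a′≈0) = record
    { Carrier         = Carrier
    ; _≈_             = λ x y → Lift c (x ≈[ a ] y)
    ; _∨_             = _∨_
    ; _∧_             = _∧_
    ; _⇒_             = _⇒_
    ; _′              = _′
    ; 0#              = 0#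
    ; 1#              = 1#
    ; ≈-isEquivalence = record
      { refl  = lift refl
      ; sym   = λ p → lift (sym (lower p))
      ; trans = λ p q → lift (trans (lower p) (lower q))
      }
    ; ∨-congruent     = λ p q → lift (≈[]-∨ (lower p) (lower q))
    ; ∧-congruent     = λ p q → lift (≈[]-∧ (lower p) (lower q))
    ; ⇒-congruent     = λ p q → lift (≈[]-⇒ (lower p) (lower q))
    ; ′-congruent     = λ p → lift (≈[]-′ a∧a′≈0 (lower p))
    }

  -- If a and a ′ are complements, then L is a subdirect product of the two
  -- corresponding quotients, so that one of them is all of L when L is
  -- subdirectly irreducible.
  complemented⇒trivial : IsSubdirectlyIrreducible L →
    ∀ {a} → a ∧ a ′ ≈ 0# → a ∨ a ′ ≈ 1# → (a ≈ 1#) ⊎ (a ≈ 0#)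
  complemented⇒trivial irreducible {a} a∧a′≈0 a∨a′≈1 =
    conclude (irreducible (Lift (c ⊔ ℓ) Bool) (quotient ∘ side ∘ lower) (λ x _ → x) embedding)
    where
    a′∧a′′≈0 : a ′ ∧ (a ′) ′ ≈ 0#
    a′∧a′′≈0 = ⊑0⇒≈0 (⊑-trans (∧-monotonic ⊑-refl (′′-⊑ a))
                 (⊑-reflexive (trans (∧-comm _ _) a∧a′≈0)))

    side : Bool → Σ[ b ∈ Carrier ] b ∧ b ′ ≈ 0#
    side true  = a , a∧a′≈0
    side false = a ′ , a′∧a′′≈0

    embedding : IsSubdirectEmbedding L (quotient ∘ side ∘ lower) (λ x _ → x)
    embedding = record
      { isHomomorphism = record
        { h-cong = λ x≈y _ → lift (∧-congˡ x≈y)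
        ; ∨-homo = λ _ _ _ → lift refl
        ; ∧-homo = λ _ _ _ → lift refl
        ; ⇒-homo = λ _ _ _ → lift refl
        ; ′-homo = λ _ _ → lift refl
        ; 0-homo = λ _ → lift refl
        ; 1-homo = λ _ → lift refl
        }
      ; injective   = λ p → ≈[]-separates a∨a′≈1
                              (lower (p (lift true))) (lower (p (lift false)))
      ; projections = λ _ y → y , lift refl
      }

    conclude : ∃[ i ] IsIsomorphism L (quotient (side (lower i))) id → (a ≈ 1#) ⊎ (a ≈ 0#)
    -- Below a the elements a and 1 agree.
    conclude (lift true , iso) =
      inj₁ (proj₁ (IsIsomorphism.bijective iso) (lift (trans (∧-idem a) (sym (∧-identityʳ a)))))
    -- Below a ′ the elements a and 0 agree.
    conclude (lift false , iso) =
      inj₂ (proj₁ (IsIsomorphism.bijective iso)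
        (lift (trans (∧-comm _ _) (trans a∧a′≈0 (sym (∧-zeroʳ (a ′)))))))

  moreThanTwo⇒1≉0 : HasMoreThanTwoElements L → ¬ (1# ≈ 0#)
  moreThanTwo⇒1≉0 (f , injective) 1≈0 =
    contradiction (injective (trans (collapsed (f zero)) (sym (collapsed (f (suc zero)))))) λ ()
    where
    collapsed : ∀ x → x ≈ 0#
    collapsed x = ⊑0⇒≈0 (⊑-trans (maximum x) (⊑-reflexive 1≈0))

-- Conditions (1), (2) and (3)

module _ {c ℓ : Level} (L : Algebra c ℓ) where
  open Algebra L

  -- The condition of (3) on the elements of L.
  IsThin : Set (c ⊔ ℓ)
  IsThin = ∀ x → ¬ (x ≈ 1#) → x ∧ (x ′) * ≈ 0#

module JID {c ℓ : Level} (L : Algebra c ℓ) (isJIDL₁ : IsJIDL₁ L) where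
  open IsJIDL₁ isJIDL₁ public
  open DQD L isDQD public

  ′-complemented : ∀ x → x ′ ∨ (x ′) * ≈ 1#
  ′-complemented x = begin
    x ′ ∨ (x ′ ⇒ 0#)            ≈⟨ jid x (x ′) 0# ⟩
    (x ′ ∨ x ′) ⇒ (x ′ ∨ 0#)    ≈⟨ ⇒-congruent (∨-idem (x ′)) (∨-identityʳ (x ′)) ⟩
    x ′ ⇒ x ′                   ≈⟨ ⇒-refl (x ′) ⟩
    1#                          ∎
    where open ≈-Reasoning setoid

  -- The level-1 identity makes a = x ∧ (x ′) * equal to (a ′) *, which is the
  -- complement of a ′.
  irreducible⇒thin : IsSubdirectlyIrreducible L → IsThin L
  irreducible⇒thin irreducible x x≉1 =
    decide (complemented⇒trivial irreducible
      (trans (∧-comm _ _) (trans (∧-congˡ (lev₁ x)) (∧-*≈0 (a ′))))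
      (trans (∨-comm _ _) (trans (∨-congˡ (lev₁ x)) (′-complemented a))))
    where
    a : Carrier
    a = x ∧ (x ′) *

    decide : (a ≈ 1#) ⊎ (a ≈ 0#) → a ≈ 0#
    decide (inj₁ a≈1) =
      contradiction (1⊑⇒≈1 (⊑-trans (⊑-reflexive (sym a≈1)) (x∧y≤x x _))) x≉1
    decide (inj₂ a≈0) = a≈0

-- A congruence other than the diagonal relates 1 to some u ≉ 1, hence relates 1 to
-- u ∧ (u ′) *, which is 0.
thin⇒simple : {c ℓ : Level} → ExcludedMiddle (c ⊔ ℓ) →
  (L : Algebra c ℓ) → IsDQD L → IsThin L → IsSimple L
thin⇒simple {c} {ℓ} em L isDQD thin θ isCongruence = decide em
  where
  open DQD L isDQD
  open IsCongruence isCongruence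
  module θ = IsEquivalence isEquivalence

  OneClassTrivial : Set (c ⊔ ℓ)
  OneClassTrivial = ∀ u → θ u 1# → u ≈ 1#

  ⇒-related : ∀ {x y} → θ x y → θ (x ⇒ y) 1#
  ⇒-related {x} {y} xθy = θ.trans (⇒-compatible xθy θ.refl) (≈⇒θ (⇒-refl y))

  diagonal : OneClassTrivial → ∀ x y → θ x y → x ≈ y
  diagonal trivial x y xθy = antisym
    (⇒≈1⇒⊑ (trivial _ (⇒-related xθy)))
    (⇒≈1⇒⊑ (trivial _ (⇒-related (θ.sym xθy))))

  full : ∀ {u} → θ u 1# → ¬ (u ≈ 1#) → ∀ x y → θ x y
  full {u} uθ1 u≉1 x y = θ.trans (xθ0 x) (θ.sym (xθ0 y))
    where
    0θ1 : θ 0# 1#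
    0θ1 = θ.trans (≈⇒θ (sym (thin u u≉1)))
      (θ.trans (∧-compatible uθ1 (⇒-compatible (′-compatible uθ1) θ.refl))
        (≈⇒θ (≈1⇒∧′*≈1 refl)))

    xθ0 : ∀ z → θ z 0#
    xθ0 z = θ.trans (≈⇒θ (sym (∧-identityʳ z)))
      (θ.trans (∧-compatible θ.refl (θ.sym 0θ1)) (≈⇒θ (∧-zeroʳ z)))

  decide : Dec (∃[ u ] θ u 1# × ¬ (u ≈ 1#)) → (∀ x y → θ x y → x ≈ y) ⊎ (∀ x y → θ x y)
  decide (yes (u , uθ1 , u≉1)) = inj₂ (full uθ1 u≉1)
  decide (no none) = inj₁ (diagonal λ u uθ1 → stable λ u≉1 → none (u , uθ1 , u≉1))
    where
    stable : ∀ {u} → ¬ ¬ (u ≈ 1#) → u ≈ 1#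
    stable ¬¬u≈1 = decidable-stable (map′ lower lift (em {Lift c _})) ¬¬u≈1

-- Each kernel of a subdirect embedding is trivial or full, and they cannot all
-- be full.
simple⇒irreducible : {c ℓ : Level} → ExcludedMiddle (c ⊔ ℓ) →
  (L : Algebra c ℓ) → ¬ Algebra._≈_ L (Algebra.1# L) (Algebra.0# L) →
  IsSimple L → IsSubdirectlyIrreducible L
simple⇒irreducible {c} {ℓ} em L 1≉0 simple I B α embedding = decide em
  where
  open Algebra L
  open IsSubdirectEmbedding embedding
  open IsHomomorphism isHomomorphism
  module B i = Algebra (B i)
  module Eq i = IsEquivalence (B.≈-isEquivalence i)

  kernel : I → Rel Carrier (c ⊔ ℓ)
  kernel i x y = B._≈_ i (α x i) (α y i)

  kernel-isCongruence : ∀ i → IsCongruence L (kernel i)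
  kernel-isCongruence i = record
    { isEquivalence = record { refl = Eq.refl i ; sym = Eq.sym i ; trans = Eq.trans i }
    ; ≈⇒θ           = λ x≈y → h-cong x≈y i
    ; ∨-compatible  = λ p q → Eq.trans i (∨-homo _ _ i)
                        (Eq.trans i (B.∨-congruent i p q) (Eq.sym i (∨-homo _ _ i)))
    ; ∧-compatible  = λ p q → Eq.trans i (∧-homo _ _ i)
                        (Eq.trans i (B.∧-congruent i p q) (Eq.sym i (∧-homo _ _ i)))
    ; ⇒-compatible  = λ p q → Eq.trans i (⇒-homo _ _ i)
                        (Eq.trans i (B.⇒-congruent i p q) (Eq.sym i (⇒-homo _ _ i)))
    ; ′-compatible  = λ p → Eq.trans i (′-homo _ i)
                        (Eq.trans i (B.′-congruent i p) (Eq.sym i (′-homo _ i)))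
    }

  Faithful : I → Set (c ⊔ ℓ)
  Faithful i = ∀ x y → kernel i x y → x ≈ y

  isomorphism : ∀ i → Faithful i → IsIsomorphism L (B i) (λ x → α x i)
  isomorphism i faithful = record
    { isHomomorphism = record
      { h-cong = λ x≈y → h-cong x≈y i
      ; ∨-homo = λ x y → ∨-homo x y i
      ; ∧-homo = λ x y → ∧-homo x y i
      ; ⇒-homo = λ x y → ⇒-homo x y i
      ; ′-homo = λ x → ′-homo x i
      ; 0-homo = 0-homo i
      ; 1-homo = 1-homo i
      }
    ; bijective = faithful _ _
                , strictlySurjective⇒surjective (Eq.trans i)
                    (λ x≈y → h-cong x≈y i) (projections i)
    }

  decide : Dec (∃[ i ] Faithful i) → ∃[ i ] IsIsomorphism L (B i) (λ x → α x i)
  decide (yes (i , faithful)) = i , isomorphism i faithful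
  decide (no none) = contradiction (injective λ i → full i) 1≉0
    where
    full : ∀ i → kernel i 1# 0#
    full i with simple (kernel i) (kernel-isCongruence i)
    ... | inj₁ faithful = contradiction (i , faithful) none
    ... | inj₂ total    = total 1# 0#

-- Homomorphisms

bijective⇒≅ : {c₁ ℓ₁ c₂ ℓ₂ : Level} (A : Algebra c₁ ℓ₁) (B : Algebra c₂ ℓ₂)
  {g : Algebra.Carrier A → Algebra.Carrier B} → IsHomomorphism A B g →
  Injective (Algebra._≈_ A) (Algebra._≈_ B) g →
  StrictlySurjective (Algebra._≈_ B) g → B ≅ A
bijective⇒≅ A B {g} isHom injective surjective = g⁻¹ , record
  { isHomomorphism = record
    { h-cong = λ {x} {y} x≈y → via (trans x≈y (sym (g∘g⁻¹ y)))
    ; ∨-homo = λ x y → via (sym (trans (∨-homo _ _) (B.∨-congruent (g∘g⁻¹ x) (g∘g⁻¹ y))))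
    ; ∧-homo = λ x y → via (sym (trans (∧-homo _ _) (B.∧-congruent (g∘g⁻¹ x) (g∘g⁻¹ y))))
    ; ⇒-homo = λ x y → via (sym (trans (⇒-homo _ _) (B.⇒-congruent (g∘g⁻¹ x) (g∘g⁻¹ y))))
    ; ′-homo = λ x → via (sym (trans (′-homo _) (B.′-congruent (g∘g⁻¹ x))))
    ; 0-homo = via (sym 0-homo)
    ; 1-homo = via (sym 1-homo)
    }
  ; bijective = (λ {x} {y} p → trans (sym (g∘g⁻¹ x)) (trans (h-cong p) (g∘g⁻¹ y)))
              , λ a → g a , λ z≈ga → via z≈ga
  }
  where
  module A = Algebra A
  module B = Algebra B
  open IsHomomorphism isHom
  open IsEquivalence B.≈-isEquivalence

  g⁻¹ : B.Carrier → A.Carrier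
  g⁻¹ y = proj₁ (surjective y)

  g∘g⁻¹ : ∀ y → g (g⁻¹ y) B.≈ y
  g∘g⁻¹ y = proj₂ (surjective y)

  via : ∀ {y a} → y B.≈ g a → g⁻¹ y A.≈ a
  via {y} y≈ga = injective (trans (g∘g⁻¹ y) y≈ga)

-- The algebra D₂

module D₂ where
  open Algebra D₂ public

  jid : ∀ x y z → x ′ ∨ (y ⇒ z) ≡ (x ′ ∨ y) ⇒ (x ′ ∨ z)
  jid x y z = ≡.cong₂ _,_
    (boolean (proj₁ (x ′)) (proj₁ y) (proj₁ z)) (boolean (proj₂ (x ′)) (proj₂ y) (proj₂ z))
    where
    boolean : ∀ p q r → p Bool.∨ (Bool.not q Bool.∨ r) ≡ Bool.not (p Bool.∨ q) Bool.∨ (p Bool.∨ r)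
    boolean false q r = ≡.refl
    boolean true  q r = ≡.refl

  lin : ∀ x y → (x ⇒ y) ∨ (y ⇒ x) ≡ 1#
  lin (p , q) (r , s) = ≡.cong₂ _,_ (boolean p r) (boolean q s)
    where
    boolean : ∀ p r → (Bool.not p Bool.∨ r) Bool.∨ (Bool.not r Bool.∨ p) ≡ true
    boolean false r     = ≡.refl
    boolean true  false = ≡.refl
    boolean true  true  = ≡.refl

  lev₁ : ∀ x → x ∧ (x ′) * ≡ ((x ∧ (x ′) *) ′) *
  lev₁ (false , false) = ≡.refl
  lev₁ (false , true)  = ≡.refl
  lev₁ (true  , false) = ≡.refl
  lev₁ (true  , true)  = ≡.refl

  thin : IsThin D₂
  thin (false , false) x≢1 = ≡.refl
  thin (false , true)  x≢1 = ≡.refl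
  thin (true  , false) x≢1 = ≡.refl
  thin (true  , true)  x≢1 = contradiction ≡.refl x≢1

-- The identities of D₂ and its thinness are reflected by injective
-- homomorphisms.
≅D₂⇒JIDL₁×thin : {c ℓ : Level} (L : Algebra c ℓ) → IsDQD L → L ≅ D₂ → IsJIDL₁ L × IsThin L
≅D₂⇒JIDL₁×thin L isDQD (h , iso) = record
  { isDQD = isDQD
  ; jid   = λ x y z → injective (jid x y z)
  ; lin   = λ x y → injective (lin x y)
  ; lev₁  = λ x → injective (lev₁ x)
  } , λ x x≉1 → injective (thin x x≉1)
  where
  open Algebra L
  open IsIsomorphism iso
  open IsHomomorphism isHomomorphism
  injective = proj₁ bijective

  jid : ∀ x y z → h (x ′ ∨ (y ⇒ z)) ≡ h ((x ′ ∨ y) ⇒ (x ′ ∨ z))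
  jid x y z
    rewrite ∨-homo (x ′) (y ⇒ z) | ⇒-homo (x ′ ∨ y) (x ′ ∨ z)
          | ∨-homo (x ′) y | ∨-homo (x ′) z | ⇒-homo y z | ′-homo x
    = D₂.jid (h x) (h y) (h z)

  lin : ∀ x y → h ((x ⇒ y) ∨ (y ⇒ x)) ≡ h 1#
  lin x y
    rewrite ∨-homo (x ⇒ y) (y ⇒ x) | ⇒-homo x y | ⇒-homo y x | 1-homo
    = D₂.lin (h x) (h y)

  ∧′*-homo : ∀ x → h (x ∧ (x ′) *) ≡ h x D₂.∧ (h x D₂.′) D₂.*
  ∧′*-homo x
    rewrite ∧-homo x ((x ′) *) | ⇒-homo (x ′) 0# | ′-homo x | 0-homo
    = ≡.refl

  lev₁ : ∀ x → h (x ∧ (x ′) *) ≡ h (((x ∧ (x ′) *) ′) *)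
  lev₁ x
    rewrite ⇒-homo ((x ∧ (x ′) *) ′) 0# | ′-homo (x ∧ (x ′) *) | ∧′*-homo x | 0-homo
    = D₂.lev₁ (h x)

  thin : ∀ x → ¬ (x ≈ 1#) → h (x ∧ (x ′) *) ≡ h 0#
  thin x x≉1
    rewrite ∧′*-homo x | 0-homo
    = D₂.thin (h x) λ hx≡1 → x≉1 (injective (≡.trans hx≡1 (≡.sym 1-homo)))

-- Dually Stone Heyting chains

-- In such a chain x ′ is 0 if x ≈ 1 and 1 otherwise; both thinness and the
-- defining identities of the subvariety follow from this.
chain⇒JIDL₁×thin : {c ℓ : Level} (L : Algebra c ℓ) → IsDStHChain L → IsJIDL₁ L × IsThin L
chain⇒JIDL₁×thin L isDStHChain = record
  { isDQD = isDQD
  ; jid   = jid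
  ; lin   = lin
  ; lev₁  = lev₁
  } , thin
  where
  open IsDStHChain isDStHChain using (isDQD; dualStone; isHeyting; isChain)
  open DQD L isDQD

  ′-trivial : ∀ x → (x ≈ 1#) ⊎ (x ′ ≈ 1#)
  ′-trivial x with isChain (x ′) ((x ′) ′)
  ... | inj₁ x′≤x′′ = inj₁ (′≈0⇒≈1 (trans (sym x′≤x′′) (dualStone x)))
  ... | inj₂ x′′≤x′ = inj₂ (′≈0⇒≈1 (trans (sym x′′≤x′) (trans (∧-comm _ _) (dualStone x))))

  ∧′*≈0 : ∀ {x} → x ′ ≈ 1# → x ∧ (x ′) * ≈ 0#
  ∧′*≈0 {x} x′≈1 = trans (∧-congˡ (trans (⇒-congruent x′≈1 refl) 1*≈0)) (∧-zeroʳ x)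

  thin : IsThin L
  thin x x≉1 with ′-trivial x
  ... | inj₁ x≈1  = contradiction x≈1 x≉1
  ... | inj₂ x′≈1 = ∧′*≈0 x′≈1

  jid : ∀ x y z → x ′ ∨ (y ⇒ z) ≈ (x ′ ∨ y) ⇒ (x ′ ∨ z)
  jid x y z with ′-trivial x
  ... | inj₁ x≈1  = trans (0∨ (y ⇒ z)) (⇒-congruent (sym (0∨ y)) (sym (0∨ z)))
    where
    0∨ : ∀ w → x ′ ∨ w ≈ w
    0∨ w = trans (∨-congʳ (trans (′-congruent x≈1) 1′)) (∨-identityˡ w)
  ... | inj₂ x′≈1 = trans (1∨ (y ⇒ z))
                      (sym (trans (⇒-congruent (1∨ y) (1∨ z)) (⇒-refl 1#)))
    where
    1∨ : ∀ w → x ′ ∨ w ≈ 1#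
    1∨ w = trans (∨-congʳ x′≈1) (∨-zeroˡ w)

  ≤⇒⇒≈1 : ∀ {x y} → x ∧ y ≈ x → x ⇒ y ≈ 1#
  ≤⇒⇒≈1 {x} {y} x≤y =
    trans (⇒-congruent (sym x≤y) refl) (IsHeyting.∧-⇒-≈1 isHeyting x y)

  lin : ∀ x y → (x ⇒ y) ∨ (y ⇒ x) ≈ 1#
  lin x y with isChain x y
  ... | inj₁ x≤y = trans (∨-congʳ (≤⇒⇒≈1 x≤y)) (∨-zeroˡ _)
  ... | inj₂ y≤x = trans (∨-congˡ (≤⇒⇒≈1 y≤x)) (∨-zeroʳ _)

  lev₁ : ∀ x → x ∧ (x ′) * ≈ ((x ∧ (x ′) *) ′) *
  lev₁ x with ′-trivial x
  ... | inj₁ x≈1  = trans a≈1 (sym (trans (⇒-congruent (trans (′-congruent a≈1) 1′) refl) (⇒-refl 0#)))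
    where
    a≈1 : x ∧ (x ′) * ≈ 1#
    a≈1 = ≈1⇒∧′*≈1 x≈1
  ... | inj₂ x′≈1 = trans a≈0 (sym (trans (⇒-congruent (trans (′-congruent a≈0) 0′) refl) 1*≈0))
    where
    a≈0 : x ∧ (x ′) * ≈ 0#
    a≈0 = ∧′*≈0 x′≈1

-- Classification of the algebras satisfying (3)

module Thin {c ℓ : Level} (em : ExcludedMiddle (c ⊔ ℓ)) (L : Algebra c ℓ)
            (isJIDL₁ : IsJIDL₁ L) (thin : IsThin L)
            (1≉0 : ¬ Algebra._≈_ L (Algebra.1# L) (Algebra.0# L)) where
  open JID L isJIDL₁

  ≈-dec : ∀ x y → Dec (x ≈ y)
  ≈-dec x y = map′ lower lift (em {Lift c (x ≈ y)})

  thin⇒⊑′ : ∀ {x} → ¬ (x ≈ 1#) → x ⊑ x ′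
  thin⇒⊑′ {x} x≉1 = ∨≈1∧≈0⇒⊑ (trans (∨-comm _ _) (′-complemented x)) (thin x x≉1)

  -- If neither x nor x ′ is 1, then x ⊑ x ′ ⊑ x ′ ′ ⊑ x.
  classify : ∀ x → (x ≈ 1#) ⊎ (x ′ ≈ 1#) ⊎ (x ′ ≈ x)
  classify x with ≈-dec x 1# | ≈-dec (x ′) 1#
  ... | yes x≈1 | _        = inj₁ x≈1
  ... | no _    | yes x′≈1 = inj₂ (inj₁ x′≈1)
  ... | no x≉1  | no x′≉1  =
    inj₂ (inj₂ (antisym (⊑-trans (thin⇒⊑′ x′≉1) (′′-⊑ x)) (thin⇒⊑′ x≉1)))

  -- If no element is fixed by ′, then x ′ ≈ 1 for every x ≉ 1, so that 1 is
  -- join-irreducible.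
  module WithoutFixedPoint (noFixedPoint : ∀ a → ¬ (a ′ ≈ a)) where

    ′-trivial : ∀ x → (x ≈ 1#) ⊎ (x ′ ≈ 1#)
    ′-trivial x with classify x
    ... | inj₁ x≈1         = inj₁ x≈1
    ... | inj₂ (inj₁ x′≈1) = inj₂ x′≈1
    ... | inj₂ (inj₂ x′≈x) = contradiction x′≈x (noFixedPoint x)

    1-joinIrreducible : ∀ {x y} → x ∨ y ≈ 1# → (x ≈ 1#) ⊎ (y ≈ 1#)
    1-joinIrreducible {x} {y} x∨y≈1 with ′-trivial x | ′-trivial y
    ... | inj₁ x≈1  | _         = inj₁ x≈1
    ... | inj₂ _    | inj₁ y≈1  = inj₂ y≈1
    ... | inj₂ x′≈1 | inj₂ y′≈1 = contradiction 1≈0 1≉0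
      where
      open ≈-Reasoning setoid
      1≈0 : 1# ≈ 0#
      1≈0 = begin
        1#                     ≈⟨ 0′ ⟨
        0# ′                   ≈⟨ ′-congruent 1′ ⟨
        (1# ′) ′               ≈⟨ ′-congruent (′-congruent x∨y≈1) ⟨
        ((x ∨ y) ′) ′          ≈⟨ ∨-′′ x y ⟩
        (x ′) ′ ∨ (y ′) ′      ≈⟨ ∨-cong (′≈1⇒′′≈0 x′≈1) (′≈1⇒′′≈0 y′≈1) ⟩
        0# ∨ 0#                ≈⟨ ∨-idem 0# ⟩
        0#                     ∎

    ⊑⇒⇒≈1 : ∀ {x y} → x ⊑ y → x ⇒ y ≈ 1#
    ⊑⇒⇒≈1 {x} {y} x⊑y with 1-joinIrreducible (lin x y)
    ... | inj₁ x⇒y≈1 = x⇒y≈1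
    ... | inj₂ y⇒x≈1 =
      trans (⇒-congruent (antisym x⊑y (⇒≈1⇒⊑ y⇒x≈1)) refl) (⇒-refl y)

    isDStHChain : IsDStHChain L
    isDStHChain = record
      { isDQD     = isDQD
      ; dualStone = dualStone
      ; isHeyting = record
        { isSemiHeyting = IsDQD.isSemiHeyting isDQD
        ; ∧-⇒-≈1        = λ x y → ⊑⇒⇒≈1 (x∧y≤y x y)
        }
      ; isChain   = total
      }
      where
      dualStone : ∀ x → x ′ ∧ (x ′) ′ ≈ 0#
      dualStone x with ′-trivial x
      ... | inj₁ x≈1  = trans (∧-congʳ (trans (′-congruent x≈1) 1′)) (∧-zeroˡ _)
      ... | inj₂ x′≈1 = trans (∧-congˡ (′≈1⇒′′≈0 x′≈1)) (∧-zeroʳ _)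

      total : Total (Algebra._≤_ L)
      total x y with 1-joinIrreducible (lin x y)
      ... | inj₁ x⇒y≈1 = inj₁ (sym (⇒≈1⇒⊑ x⇒y≈1))
      ... | inj₂ y⇒x≈1 = inj₂ (sym (⇒≈1⇒⊑ y⇒x≈1))

  fixed⇒≉0 : ∀ {a} → a ′ ≈ a → ¬ (a ≈ 0#)
  fixed⇒≉0 a′≈a a≈0 = 1≉0 (trans (sym 0′) (trans (sym (′-congruent a≈0)) (trans a′≈a a≈0)))

  fixed⇒≉1 : ∀ {a} → a ′ ≈ a → ¬ (a ≈ 1#)
  fixed⇒≉1 a′≈a a≈1 = fixed⇒≉0 a′≈a (trans (sym a′≈a) (trans (′-congruent a≈1) 1′))

  fixed⇒′′ : ∀ {a} → a ′ ≈ a → (a ′) ′ ≈ a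
  fixed⇒′′ a′≈a = trans (′-congruent a′≈a) a′≈a

  ′≈1⇒⊑fixed : ∀ {a x} → a ′ ≈ a → x ′ ≈ 1# → x ⊑ a
  ′≈1⇒⊑fixed {a} {x} a′≈a x′≈1 = decide (classify (x ∨ a))
    where
    open ≈-Reasoning setoid
    ′′≈a : ((x ∨ a) ′) ′ ≈ a
    ′′≈a = begin
      ((x ∨ a) ′) ′        ≈⟨ ∨-′′ x a ⟩
      (x ′) ′ ∨ (a ′) ′    ≈⟨ ∨-cong (′≈1⇒′′≈0 x′≈1) (fixed⇒′′ a′≈a) ⟩
      0# ∨ a               ≈⟨ ∨-identityˡ a ⟩
      a                    ∎

    decide : (x ∨ a ≈ 1#) ⊎ ((x ∨ a) ′ ≈ 1#) ⊎ ((x ∨ a) ′ ≈ x ∨ a) → x ⊑ a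
    decide (inj₁ x∨a≈1) = contradiction
      (trans (sym ′′≈a) (trans (′-congruent (trans (′-congruent x∨a≈1) 1′)) 0′)) (fixed⇒≉1 a′≈a)
    decide (inj₂ (inj₁ [x∨a]′≈1)) = contradiction
      (trans (sym ′′≈a) (′≈1⇒′′≈0 [x∨a]′≈1)) (fixed⇒≉0 a′≈a)
    decide (inj₂ (inj₂ fixed)) =
      ⊑-trans (x≤x∨y x a) (⊑-reflexive (trans (sym (fixed⇒′′ fixed)) ′′≈a))

  fixed-∨ : ∀ {a x} → a ′ ≈ a → x ′ ≈ x → (x ∨ a ≈ 1#) ⊎ (x ≈ a)
  fixed-∨ {a} {x} a′≈a x′≈x = decide (classify (x ∨ a))
    where
    ′′≈ : ((x ∨ a) ′) ′ ≈ x ∨ a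
    ′′≈ = trans (∨-′′ x a) (∨-cong (fixed⇒′′ x′≈x) (fixed⇒′′ a′≈a))

    decide : (x ∨ a ≈ 1#) ⊎ ((x ∨ a) ′ ≈ 1#) ⊎ ((x ∨ a) ′ ≈ x ∨ a) → (x ∨ a ≈ 1#) ⊎ (x ≈ a)
    decide (inj₁ x∨a≈1) = inj₁ x∨a≈1
    decide (inj₂ (inj₁ [x∨a]′≈1)) = contradiction
      (⊑0⇒≈0 (⊑-trans (x≤x∨y x a) (⊑-reflexive (trans (sym ′′≈) (′≈1⇒′′≈0 [x∨a]′≈1)))))
      (fixed⇒≉0 x′≈x)
    -- Here x ∨ a ≈ (x ∨ a) ′ lies below both x ′ ≈ x and a ′ ≈ a.
    decide (inj₂ (inj₂ fixed)) = inj₂ (antisym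
      (⊑-trans (x≤x∨y x a) (below a′≈a (y≤x∨y x a)))
      (⊑-trans (y≤x∨y x a) (below x′≈x (x≤x∨y x a))))
      where
      below : ∀ {y} → y ′ ≈ y → y ⊑ x ∨ a → x ∨ a ⊑ y
      below y′≈y y⊑ = ⊑-trans (⊑-reflexive (sym fixed)) (⊑-trans (′-antitone y⊑) (⊑-reflexive y′≈y))

  -- A fixed point a of ′ and its complement b = a * are the two atoms of a
  -- four-element Boolean algebra that exhausts L.
  module WithFixedPoint (a : Carrier) (a′≈a : a ′ ≈ a) where

    b : Carrier
    b = a *

    a∧b≈0 : a ∧ b ≈ 0#
    a∧b≈0 = ∧-*≈0 a

    b∧a≈0 : b ∧ a ≈ 0#
    b∧a≈0 = trans (∧-comm b a) a∧b≈0

    a∨b≈1 : a ∨ b ≈ 1#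
    a∨b≈1 = begin
      a ∨ a *          ≈⟨ ∨-cong a′≈a (⇒-congruent a′≈a refl) ⟨
      a ′ ∨ (a ′) *    ≈⟨ ′-complemented a ⟩
      1#               ∎
      where open ≈-Reasoning setoid

    b′≈b : b ′ ≈ b
    b′≈b with classify b
    ... | inj₁ b≈1         = contradiction
      (trans (sym (∧-identityʳ a)) (trans (∧-congˡ (sym b≈1)) a∧b≈0)) (fixed⇒≉0 a′≈a)
    ... | inj₂ (inj₁ b′≈1) = contradiction
      (1⊑⇒≈1 (⊑-trans (⊑-reflexive (sym a∨b≈1)) (∨-least ⊑-refl (′≈1⇒⊑fixed a′≈a b′≈1))))
      (fixed⇒≉1 a′≈a)
    ... | inj₂ (inj₂ fixed) = fixed

    exhaust : ∀ x → (x ≈ 0#) ⊎ (x ≈ a) ⊎ (x ≈ b) ⊎ (x ≈ 1#)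
    exhaust x with classify x
    ... | inj₁ x≈1         = inj₂ (inj₂ (inj₂ x≈1))
    ... | inj₂ (inj₁ x′≈1) = inj₁ (⊑0⇒≈0 (⊑-trans
      (∧-greatest (′≈1⇒⊑fixed a′≈a x′≈1) (′≈1⇒⊑fixed b′≈b x′≈1)) (⊑-reflexive a∧b≈0)))
    ... | inj₂ (inj₂ x′≈x) with fixed-∨ a′≈a x′≈x | fixed-∨ b′≈b x′≈x
    ...   | inj₂ x≈a   | _          = inj₂ (inj₁ x≈a)
    ...   | inj₁ _     | inj₂ x≈b   = inj₂ (inj₂ (inj₁ x≈b))
    ...   | inj₁ x∨a≈1 | inj₁ x∨b≈1 = inj₂ (inj₂ (inj₂ (1⊑⇒≈1 1⊑x)))
      where
      1⊑x : 1# ⊑ x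
      1⊑x = ⊑-trans (⊑-reflexive (sym a∨b≈1)) (∨-least
        (∨≈1∧≈0⇒⊑ (trans (∨-comm b x) x∨b≈1) a∧b≈0)
        (∨≈1∧≈0⇒⊑ (trans (∨-comm a x) x∨a≈1) b∧a≈0))

    0⇒1≈1 : 0# ⇒ 1# ≈ 1#
    0⇒1≈1 = begin
      0# ⇒ 1#                  ≈⟨ ∨-identityʳ _ ⟨
      (0# ⇒ 1#) ∨ 0#           ≈⟨ ∨-congˡ 1*≈0 ⟨
      (0# ⇒ 1#) ∨ (1# ⇒ 0#)    ≈⟨ lin 0# 1# ⟩
      1#                       ∎
      where open ≈-Reasoning setoid

    -- The embedding of the two-element Boolean algebra into L.
    bit : Bool → Carrier
    bit p = if p then 1# else 0#

    bit-∨ : ∀ p q → bit (p Bool.∨ q) ≈ bit p ∨ bit q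
    bit-∨ false q = sym (∨-identityˡ (bit q))
    bit-∨ true  q = sym (∨-zeroˡ (bit q))

    bit-∧ : ∀ p q → bit (p Bool.∧ q) ≈ bit p ∧ bit q
    bit-∧ false q = sym (∧-zeroˡ (bit q))
    bit-∧ true  q = sym (∧-identityˡ (bit q))

    bit-⇒ : ∀ p q → bit (Bool.not p Bool.∨ q) ≈ bit p ⇒ bit q
    bit-⇒ false false = sym (⇒-refl 0#)
    bit-⇒ false true  = sym 0⇒1≈1
    bit-⇒ true  q     = sym (1⇒-identity (bit q))

    -- The element of L whose restrictions to a and b are the given bits.
    glue : Bool × Bool → Carrier
    glue (p , q) = (a ∧ bit p) ∨ (b ∧ bit q)

    restrict : ∀ {d e} → d ∧ e ≈ 0# → ∀ x y → (d ∧ x) ∨ (e ∧ y) ≈[ d ] x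
    restrict {d} {e} d∧e≈0 x y = begin
      d ∧ ((d ∧ x) ∨ (e ∧ y))          ≈⟨ ∧-distribˡ-∨ d _ _ ⟩
      (d ∧ (d ∧ x)) ∨ (d ∧ (e ∧ y))    ≈⟨ ∨-cong (∧-∧-absorb d x) (sym (∧-assoc d e y)) ⟩
      (d ∧ x) ∨ ((d ∧ e) ∧ y)          ≈⟨ ∨-congˡ (trans (∧-congʳ d∧e≈0) (∧-zeroˡ y)) ⟩
      (d ∧ x) ∨ 0#                     ≈⟨ ∨-identityʳ _ ⟩
      d ∧ x                            ∎
      where open ≈-Reasoning setoid

    glue-a : ∀ s → glue s ≈[ a ] bit (proj₁ s)
    glue-a (p , q) = restrict a∧b≈0 (bit p) (bit q)

    glue-b : ∀ s → glue s ≈[ b ] bit (proj₂ s)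
    glue-b (p , q) = trans (∧-congˡ (∨-comm _ _)) (restrict b∧a≈0 (bit q) (bit p))

    glue-unique : ∀ s {x} → bit (proj₁ s) ≈[ a ] x → bit (proj₂ s) ≈[ b ] x → glue s ≈ x
    glue-unique s p q = ≈[]-separates a∨b≈1 (trans (glue-a s) p) (trans (glue-b s) q)

    glue-0 : glue D₂.0# ≈ 0#
    glue-0 = glue-unique D₂.0# refl refl

    glue-1 : glue D₂.1# ≈ 1#
    glue-1 = glue-unique D₂.1# refl refl

    glue-10 : glue (true , false) ≈ a
    glue-10 = glue-unique (true , false)
      (trans (∧-identityʳ a) (sym (∧-idem a))) (trans (∧-zeroʳ b) (sym b∧a≈0))

    glue-01 : glue (false , true) ≈ b
    glue-01 = glue-unique (false , true)
      (trans (∧-zeroʳ a) (sym a∧b≈0)) (trans (∧-identityʳ b) (sym (∧-idem b)))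

    glue-′ : ∀ s → glue (s D₂.′) ≈ glue s ′
    glue-′ (false , false) = trans glue-1 (sym (trans (′-congruent glue-0) 0′))
    glue-′ (true  , true)  = trans glue-0 (sym (trans (′-congruent glue-1) 1′))
    glue-′ (true  , false) = trans glue-10 (sym (trans (′-congruent glue-10) a′≈a))
    glue-′ (false , true)  = trans glue-01 (sym (trans (′-congruent glue-01) b′≈b))

    glue-isHomomorphism : IsHomomorphism D₂ L glue
    glue-isHomomorphism = record
      { h-cong = λ { ≡.refl → refl }
      ; ∨-homo = λ s t → glue-unique (s D₂.∨ t)
          (trans (∧-congˡ (bit-∨ _ _)) (sym (≈[]-∨ (glue-a s) (glue-a t))))
          (trans (∧-congˡ (bit-∨ _ _)) (sym (≈[]-∨ (glue-b s) (glue-b t))))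
      ; ∧-homo = λ s t → glue-unique (s D₂.∧ t)
          (trans (∧-congˡ (bit-∧ _ _)) (sym (≈[]-∧ (glue-a s) (glue-a t))))
          (trans (∧-congˡ (bit-∧ _ _)) (sym (≈[]-∧ (glue-b s) (glue-b t))))
      ; ⇒-homo = λ s t → glue-unique (s D₂.⇒ t)
          (trans (∧-congˡ (bit-⇒ _ _)) (sym (≈[]-⇒ (glue-a s) (glue-a t))))
          (trans (∧-congˡ (bit-⇒ _ _)) (sym (≈[]-⇒ (glue-b s) (glue-b t))))
      ; ′-homo = glue-′
      ; 0-homo = glue-0
      ; 1-homo = glue-1
      }

    bit-injective : ∀ {d} → ¬ (d ≈ 0#) → ∀ p q → bit p ≈[ d ] bit q → p ≡ q
    bit-injective         d≉0 false false _     = ≡.refl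
    bit-injective         d≉0 true  true  _     = ≡.refl
    bit-injective {d = d} d≉0 true  false 1≈0 =
      contradiction (trans (sym (∧-identityʳ d)) (trans 1≈0 (∧-zeroʳ d))) d≉0
    bit-injective         d≉0 false true  0≈1 =
      ≡.sym (bit-injective d≉0 true false (sym 0≈1))

    glue-injective : Injective _≡_ _≈_ glue
    glue-injective {s} {t} eq = ≡.cong₂ _,_
      (bit-injective (fixed⇒≉0 a′≈a) _ _
        (trans (sym (glue-a s)) (trans (∧-congˡ eq) (glue-a t))))
      (bit-injective (fixed⇒≉0 b′≈b) _ _
        (trans (sym (glue-b s)) (trans (∧-congˡ eq) (glue-b t))))

    glue-surjective : StrictlySurjective _≈_ glue
    glue-surjective x with exhaust x
    ... | inj₁ x≈0               = D₂.0# , trans glue-0 (sym x≈0)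
    ... | inj₂ (inj₁ x≈a)        = (true , false) , trans glue-10 (sym x≈a)
    ... | inj₂ (inj₂ (inj₁ x≈b)) = (false , true) , trans glue-01 (sym x≈b)
    ... | inj₂ (inj₂ (inj₂ x≈1)) = D₂.1# , trans glue-1 (sym x≈1)

    isomorphic : L ≅ D₂
    isomorphic = bijective⇒≅ D₂ L glue-isHomomorphism glue-injective glue-surjective

  ≅D₂⊎chain : (L ≅ D₂) ⊎ IsDStHChain L
  ≅D₂⊎chain = decide em
    where
    decide : Dec (∃[ a ] a ′ ≈ a) → (L ≅ D₂) ⊎ IsDStHChain L
    decide (yes (a , a′≈a)) = inj₁ (WithFixedPoint.isomorphic a a′≈a)
    decide (no none)        =
      inj₂ (WithoutFixedPoint.isDStHChain λ a a′≈a → none (a , a′≈a))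

-- The equivalences

theorem6p7 : {c ℓ : Level} → ExcludedMiddle (c ⊔ ℓ) →
    (L : Algebra c ℓ) → IsDQD L → HasMoreThanTwoElements L →
    let open Algebra L
        [1] = IsJIDL₁ L × IsSubdirectlyIrreducible L
        [2] = IsJIDL₁ L × IsSimple L
        [3] = IsJIDL₁ L × (∀ x → ¬ (x ≈ 1#) → x ∧ (x ′) * ≈ 0#)
        [4] = (L ≅ D₂) ⊎ IsDStHChain L
    in ([1] ⇔ [2]) × ([2] ⇔ [3]) × ([3] ⇔ [4])
theorem6p7 em L isDQD moreThanTwo =
    mk⇔ (λ (jidl , irr) → jidl , thin⇒simple em L isDQD (JID.irreducible⇒thin L jidl irr))
        (λ (jidl , simple) → jidl , simple⇒irreducible em L 1≉0 simple)
  , mk⇔ (λ (jidl , simple) → jidl ,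
           JID.irreducible⇒thin L jidl (simple⇒irreducible em L 1≉0 simple))
        (λ (jidl , thin) → jidl , thin⇒simple em L isDQD thin)
  , mk⇔ (λ (jidl , thin) → Thin.≅D₂⊎chain em L jidl thin 1≉0)
        (λ { (inj₁ iso)   → ≅D₂⇒JIDL₁×thin L isDQD iso
           ; (inj₂ chain) → chain⇒JIDL₁×thin L chain
           })
  where
  1≉0 = DQD.moreThanTwo⇒1≉0 L isDQD moreThanTwo
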